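{- There exist sets $A,B,C\subseteq\Sigma^*$ such that $B\leq^p_{ld\text{ - }T}A$, $B\not\leq^p_{s\text{ - }lni\text{ - }T}A$, $C\leq^p_{s\text{ - }lni\text{ - }T}A$, and $C\not\leq^p_{ld\text{ - }T}A$.
   Context: $\Sigma=\{0,1\}$; $|x|$ is the length of $x$. A DPTM is a deterministic oracle Turing machine $M$ for which there is one polynomial $p$ such that, for every oracle $X\subseteq\Sigma^*$ and input $x$, $M^X(x)$ halts within $p(|x|)$ steps; $L(M^X)$ is the set of inputs accepted with oracle $X$. $D\leq^p_{ld\text{ - }T}A$ (respectively $D\leq^p_{s\text{ - }lni\text{ - }T}A$): there is a DPTM $M$ with $L(M^A)=D$ such that for every input $x$, either $M^A(x)$ makes no oracle queries, or the sequence $q_1,\dots,q_k$ ($k\ge1$), in order, of its queries satisfies $|q_1|>|q_2|>\dots>|q_k|$ (respectively $|x|\ge|q_1|\ge|q_2|\ge\dots\ge|q_k|$). -}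

module Defs where

open import Data.Bool using (Bool; true; false; if_then_else_)
open import Data.Fin using (Fin)
open import Data.List using (List; []; _∷_; _∷ʳ_; _++_; foldr; length; map)
open import Data.List.Relation.Unary.Linked using (Linked)
open import Data.Maybe using (Maybe; just; nothing)
open import Data.Nat using (ℕ; zero; suc; _+_; _*_; _≥_; _>_)
open import Data.Product using (Σ-syntax; _×_; _,_)
open import Data.Sum using (_⊎_)
open import Data.Unit using (⊤)
open import Data.Empty using (⊥)
open import Data.Vec as Vec using (Vec)
open import Relation.Binary.PropositionalEquality using (_≡_; _≗_)

Word : Set
Word = List Bool

-- A set of words is given by its characteristic function.
Language : Set
Language = Word → Bool

-- Coefficients, lowest degree first.
Polynomial : Set
Polynomial = List ℕ

eval : Polynomial → ℕ → ℕ
eval p n = foldr (λ a v → a + n * v) 0 p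

data Symbol (g : ℕ) : Set where
  blank : Symbol g
  bit   : Bool → Symbol g
  aux   : Fin g → Symbol g

data Move : Set where
  left stay right : Move

-- What a machine with s states, k work tapes and g auxiliary tape symbols
-- does in a given state.  Besides its work tapes (the first of which initially
-- holds the input) it has a write-only oracle tape: a transition may append
-- one bit to it.
record Action (s k g : ℕ) : Set where
  constructor action
  field
    next  : Fin s
    write : Vec (Symbol g × Move) k
    emit  : Maybe Bool

data Instruction (s k g : ℕ) : Set where
  accept reject : Instruction s k g
  query         : (yes no : Fin s) → Instruction s k g
  compute       : (Vec (Symbol g) k → Action s k g) → Instruction s k g

record OracleTM : Set where
  field
    states extraTapes auxSymbols : ℕ
    start   : Fin states
    program : Fin states → Instruction states (suc extraTapes) auxSymbols

-- A two-way infinite tape; all cells not listed are blank.  The cells to the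
-- left of the head are listed starting from the one nearest to the head.
record Tape (g : ℕ) : Set where
  constructor tape
  field
    before : List (Symbol g)
    head   : Symbol g
    after  : List (Symbol g)

module _ {g : ℕ} where

  blankTape : Tape g
  blankTape = tape [] blank []

  inputTape : Word → Tape g
  inputTape []      = blankTape
  inputTape (b ∷ w) = tape [] (bit b) (map bit w)

  move : Move → Tape g → Tape g
  move stay  t                  = t
  move left  (tape []      a r) = tape [] blank (a ∷ r)
  move left  (tape (b ∷ l) a r) = tape l b (a ∷ r)
  move right (tape l a [])      = tape (a ∷ l) blank []
  move right (tape l a (b ∷ r)) = tape (a ∷ l) b r

  update : Symbol g × Move → Tape g → Tape g
  update (a , m) (tape l _ r) = move m (tape l a r)

append : Maybe Bool → Word → Word
append nothing  w = w
append (just b) w = w ∷ʳ b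

module _ (M : OracleTM) where
  open OracleTM M

  record Config : Set where
    constructor config
    field
      state      : Fin states
      workTapes  : Vec (Tape auxSymbols) (suc extraTapes)
      oracleTape : Word

  open Config

  initial : Word → Config
  initial x = config start (inputTape x Vec.∷ Vec.replicate extraTapes blankTape) []

  -- Halting configurations are fixed points.  A query takes one step and
  -- empties the oracle tape.
  step : Language → Config → Config
  step X c with program (state c)
  ... | accept       = c
  ... | reject       = c
  ... | query yes no =
    config (if X (oracleTape c) then yes else no) (workTapes c) []
  ... | compute δ    =
    let action q ws e = δ (Vec.map Tape.head (workTapes c))
    in config q (Vec.zipWith update ws (workTapes c)) (append e (oracleTape c))

  run : Language → ℕ → Config → Config
  run X zero    c = c
  run X (suc t) c = run X t (step X c)

  queriesAt : Config → List Word
  queriesAt c with program (state c)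
  ... | query _ _ = oracleTape c ∷ []
  ... | _         = []

  queriesWithin : Language → ℕ → Config → List Word
  queriesWithin X zero    c = []
  queriesWithin X (suc t) c = queriesAt c ++ queriesWithin X t (step X c)

  Halted : Config → Set
  Halted c with program (state c)
  ... | accept = ⊤
  ... | reject = ⊤
  ... | _      = ⊥

  accepting : Config → Bool
  accepting c with program (state c)
  ... | accept = true
  ... | _      = false

record DPTM : Set where
  field
    machine : OracleTM
    bound   : Polynomial
    halts   : ∀ (X : Language) (x : Word) →
              Halted machine (run machine X (eval bound (length x)) (initial machine x))

-- The machine has halted after `eval bound (length x)` steps and nothing
-- changes afterwards, so that many steps determine the outcome and the complete
-- sequence of queries (in the order in which they are made).
module _ (M : DPTM) (X : Language) where
  open DPTM M

  L : Language
  L x = accepting machine (run machine X (eval bound (length x)) (initial machine x))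

  queries : Word → List Word
  queries x = queriesWithin machine X (eval bound (length x)) (initial machine x)

infix 4 _≤ld-T_ _≤s-lni-T_

_≤ld-T_ : Language → Language → Set
D ≤ld-T A = Σ[ M ∈ DPTM ] (L M A ≗ D) ×
  (∀ x → queries M A x ≡ [] ⊎ Linked _>_ (map length (queries M A x)))

_≤s-lni-T_ : Language → Language → Set
D ≤s-lni-T A = Σ[ M ∈ DPTM ] (L M A ≗ D) ×
  (∀ x → queries M A x ≡ [] ⊎ Linked _≥_ (length x ∷ map length (queries M A x)))

{-# OPTIONS --safe #-}
module Submission where

-- Both B and C ask whether the oracle contains one of finitely many target words
-- determined by n = |x|: the single target 0ⁿ⁺¹ for B, the targets 0ⁿ and 1ⁿ for C.
-- A is built in stages against an enumeration, for B and for C, of all machines with a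
-- polynomial time bound.  A stage runs its machine on an input 0ⁿ, with n above everything
-- fixed before, and if the machine rejects, all targets it has not queried are
-- put into A.  Later stages act beyond the reach of this computation, so the
-- machine errs on 0ⁿ unless it queries every target.  But a reduction of B to A
-- may not query 0ⁿ⁺¹ when its queries are no longer than the input, and a
-- reduction of C to A may not query both 0ⁿ and 1ⁿ when their lengths must
-- strictly decrease.

open import Defs
open import Data.Bool using (Bool; true; false; if_then_else_; _∨_)
open import Data.Bool.ListAction using (any)
import Data.Bool.Properties as Bool
open import Data.Fin using (Fin; zero; suc)
open import Data.Fin.Patterns using (0F; 1F; 2F; 3F; 4F; 5F)
open import Data.List
  using (List; []; _∷_; _∷ʳ_; _++_; allFin; length; map; replicate; lookup; tabulate)
open import Data.List.Membership.Propositional using (_∈_; _∉_)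
open import Data.List.Membership.Propositional.Properties
  using (∈-allFin; ∈-map⁺; ∈-++⁺ˡ; ∈-++⁺ʳ; ∈-++⁻)
open import Data.List.Properties
  using (≡-dec; length-replicate; length-++; tabulate-cong; tabulate-lookup)
open import Data.List.Relation.Unary.All as All using (All; []; _∷_)
open import Data.List.Relation.Unary.AllPairs using (AllPairs; _∷_)
open import Data.List.Relation.Unary.Any using (Any; here; there)
open import Data.List.Relation.Unary.Linked as Linked using (Linked; [-]; _∷_)
import Data.List.Relation.Unary.Linked.Properties as Linked
open import Data.Maybe as Maybe using (Maybe; just; nothing)
open import Data.Nat
  using (ℕ; zero; suc; _+_; _*_; _∸_; _≤_; _<_; _≥_; _>_; z≤n; s≤s; s≤s⁻¹)
open import Data.Nat.Properties
open import Data.Nat.Tactic.RingSolver using (solve-∀)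
open import Data.Product using (∃-syntax; _×_; _,_; proj₁; proj₂)
open import Data.Sum using (_⊎_; inj₁; inj₂)
open import Data.Unit using (tt)
open import Data.Vec as Vec using (Vec; []; _∷_)
import Data.Vec.Properties as Vec
open import Function using (_∘_; const; id)
open import Relation.Binary.PropositionalEquality
  using (_≡_; refl; sym; trans; cong; cong₂; subst; subst₂; module ≡-Reasoning)
open import Relation.Nullary using (¬_; does; contradiction)
open import Relation.Nullary.Decidable using (dec-true; dec-false; ¬?; _×-dec_; decidable-stable)
open import Relation.Unary using (Decidable)

open import Data.List.Membership.DecPropositional (≡-dec Bool._≟_) using (_∈?_)

-- Partial enumerations and dovetailing.

next : ℕ × ℕ → ℕ × ℕ
next (zero  , b) = suc b , zero
next (suc a , b) = a , suc b

-- The inverse of the Cantor pairing: `next` runs along each antidiagonal and, when the first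
-- coordinate is 0, passes to the next antidiagonal.
unpair : ℕ → ℕ × ℕ
unpair zero    = 0 , 0
unpair (suc n) = next (unpair n)

-- Undoing `next` lowers `b` along one antidiagonal and, at `b = 0`, falls back to the end of the
-- previous one; the recursion is lexicographic in `s` and `b`.
unpair-surjective : ∀ a b → ∃[ n ] unpair n ≡ (a , b)
unpair-surjective a b = onDiagonal (a + b) a b refl
  where
  onDiagonal : ∀ s a b → a + b ≡ s → ∃[ n ] unpair n ≡ (a , b)
  onDiagonal s a (suc b) eq =
    let n , p = onDiagonal s (suc a) b (trans (sym (+-suc a b)) eq)
    in suc n , cong next p
  onDiagonal s       zero    zero eq = 0 , refl
  onDiagonal (suc s) (suc a) zero eq =
    let n , p = onDiagonal s 0 a (trans (sym (+-identityʳ a)) (suc-injective eq))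
    in suc n , cong next p

-- Partiality accommodates empty choices, such as a start state in `Fin 0`.
record Enum (A : Set) : Set where
  no-eta-equality
  field at : ℕ → Maybe A

open Enum

-- Functions are only ever enumerated up to pointwise equality, so what is
-- recorded about an enumeration is that it hits a predicate.
record Hits {A : Set} (f : Enum A) (P : A → Set) : Set where
  constructor hit
  field
    {index} : ℕ
    {value} : A
    found   : f .at index ≡ just value
    holds   : P value

private
  variable
    A B : Set
    P Q : A → Set

return : A → Enum A
return a .at _ = just a

infixl 1 _>>=_
_>>=_ : Enum A → (A → Enum B) → Enum B
(f >>= g) .at n = let i , j = unpair n in f .at i Maybe.>>= λ a → g a .at j

hits-return : ∀ {a} → P a → Hits (return a) P
hits-return p = hit {index = 0} refl p

-- Completeness of every compound enumeration is assembled from this. Since `f` is only known to hit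
-- `P`, the second premise has to serve whichever value satisfying `P` turns up.
hits->>= : {f : Enum A} {g : A → Enum B} →
           Hits f P → (∀ a → P a → Hits (g a) Q) → Hits (f >>= g) Q
hits->>= {f = f} {g} (hit {i} {a} fi p) h with h a p
... | hit {j} {b} gj q with unpair-surjective i j
... | n , n≡ = hit {index = n} eq q
  where
  eq : (f >>= g) .at n ≡ just b
  eq rewrite n≡ | fi = gj

choose : List A → Enum A
choose []       .at _       = nothing
choose (x ∷ xs) .at zero    = just x
choose (x ∷ xs) .at (suc n) = choose xs .at n

hits-choose : ∀ {xs : List A} → Any P xs → Hits (choose xs) P
hits-choose (here p)  = hit {index = 0} refl p
hits-choose (there a) = let hit {n} found p = hits-choose a in hit {index = suc n} found p

naturals : Enum ℕ
naturals .at n = just n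

hits-naturals : ∀ n → Hits naturals (n ≡_)
hits-naturals n = hit {index = n} refl refl

hits-∈ : ∀ {xs : List A} {x} → x ∈ xs → Hits (choose xs) (x ≡_)
hits-∈ = hits-choose

-- Enumerating finite functions, vectors and polynomials.

functions : ∀ {n} → Enum A → Enum (Fin n → A)
functions {n = zero}  e = return λ ()
functions {n = suc n} e =
  e >>= λ a → functions e >>= λ h → return λ { zero → a ; (suc i) → h i }

-- A separate predicate for each argument replaces an equation between functions, and also covers
-- entries that are themselves known only up to an equivalence.
hits-functions : ∀ {n} {e : Enum A} {P : Fin n → A → Set} →
                 (∀ i → Hits e (P i)) → Hits (functions e) (λ h → ∀ i → P i (h i))
hits-functions {n = zero}  _ = hits-return λ ()
hits-functions {n = suc n} p =
  hits->>= (p zero) λ a pa → hits->>= (hits-functions (p ∘ suc)) λ h ph →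
  hits-return λ { zero → pa ; (suc i) → ph i }

vectors : ∀ {n} → Enum A → Enum (Vec A n)
vectors e = functions e >>= λ h → return (Vec.tabulate h)

hits-vectors : ∀ {n} {e : Enum A} → (∀ a → Hits e (a ≡_)) →
               (v : Vec A n) → Hits (vectors e) (v ≡_)
hits-vectors p v =
  hits->>= (hits-functions (p ∘ Vec.lookup v)) λ h eq →
  hits-return (trans (sym (Vec.tabulate∘lookup v)) (Vec.tabulate-cong eq))

polynomials : Enum Polynomial
polynomials = naturals >>= λ n → functions {n = n} naturals >>= λ h → return (tabulate h)

hits-polynomials : ∀ p → Hits polynomials (p ≡_)
hits-polynomials p =
  hits->>= (hits-naturals (length p)) λ { _ refl →
  hits->>= (hits-functions (hits-naturals ∘ lookup p)) λ h eq →
  hits-return (trans (sym (tabulate-lookup p)) (tabulate-cong eq)) }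

-- Enumerating oracle machines.

symbols : ∀ {g} → List (Symbol g)
symbols = blank ∷ bit true ∷ bit false ∷ map aux (allFin _)

∈-symbols : ∀ {g} (a : Symbol g) → a ∈ symbols
∈-symbols blank       = here refl
∈-symbols (bit true)  = there (here refl)
∈-symbols (bit false) = there (there (here refl))
∈-symbols (aux i)     = there (there (there (∈-map⁺ aux (∈-allFin i))))

moves : List Move
moves = left ∷ stay ∷ right ∷ []

∈-moves : ∀ m → m ∈ moves
∈-moves left  = here refl
∈-moves stay  = there (here refl)
∈-moves right = there (there (here refl))

emissions : List (Maybe Bool)
emissions = nothing ∷ just true ∷ just false ∷ []

∈-emissions : ∀ m → m ∈ emissions
∈-emissions nothing      = here refl
∈-emissions (just true)  = there (here refl)
∈-emissions (just false) = there (there (here refl))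

symbolFunctions : ∀ {g} → Enum A → Enum (Symbol g → A)
symbolFunctions e =
  e >>= λ b → e >>= λ t → e >>= λ f → functions e >>= λ h →
  return λ { blank → b ; (bit true) → t ; (bit false) → f ; (aux i) → h i }

hits-symbolFunctions : ∀ {g} {e : Enum A} {P : Symbol g → A → Set} →
  (∀ a → Hits e (P a)) → Hits (symbolFunctions e) (λ h → ∀ a → P a (h a))
hits-symbolFunctions p =
  hits->>= (p blank) λ _ pb → hits->>= (p (bit true)) λ _ pt →
  hits->>= (p (bit false)) λ _ pf → hits->>= (hits-functions (p ∘ aux)) λ _ ph →
  hits-return λ { blank → pb ; (bit true) → pt ; (bit false) → pf ; (aux i) → ph i }

-- Currying turns a function of k scanned symbols into a finite nested table, one level per tape.
readingFunctions : ∀ {g} k → Enum A → Enum (Vec (Symbol g) k → A)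
readingFunctions zero    e = e >>= λ a → return λ _ → a
readingFunctions (suc k) e =
  symbolFunctions (readingFunctions k e) >>= λ h → return λ { (a ∷ v) → h a v }

hits-readingFunctions : ∀ {g} k {e : Enum A} {P : Vec (Symbol g) k → A → Set} →
  (∀ v → Hits e (P v)) → Hits (readingFunctions k e) (λ h → ∀ v → P v (h v))
hits-readingFunctions zero    p =
  hits->>= (p []) λ _ q → hits-return λ { [] → q }
hits-readingFunctions (suc k) p =
  hits->>= (hits-symbolFunctions λ a → hits-readingFunctions k (p ∘ (a ∷_))) λ _ q →
  hits-return λ { (a ∷ v) → q a v }

actions : ∀ {s k g} → Enum (Action s k g)
actions =
  choose (allFin _) >>= λ q →
  vectors (choose symbols >>= λ a → choose moves >>= λ m → return (a , m)) >>= λ ws →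
  choose emissions >>= λ e → return (action q ws e)

hits-actions : ∀ {s k g} (a : Action s k g) → Hits actions (a ≡_)
hits-actions (action q ws e) =
  hits->>= (hits-∈ (∈-allFin q)) λ { _ refl →
  hits->>= (hits-vectors hits-cell ws) λ { _ refl →
  hits->>= (hits-∈ (∈-emissions e)) λ { _ refl → hits-return refl }}}
  where
  hits-cell : ∀ c → Hits (choose symbols >>= λ a → choose moves >>= λ m → return (a , m)) (c ≡_)
  hits-cell (a , m) =
    hits->>= (hits-∈ (∈-symbols a)) λ { _ refl →
    hits->>= (hits-∈ (∈-moves m)) λ { _ refl → hits-return refl }}

data _≈ᴵ_ {s k g} : Instruction s k g → Instruction s k g → Set where
  accept  : accept ≈ᴵ accept
  reject  : reject ≈ᴵ reject
  query   : ∀ {y n} → query y n ≈ᴵ query y n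
  compute : ∀ {δ ε} → (∀ v → δ v ≡ ε v) → compute δ ≈ᴵ compute ε

queryInstructions computeInstructions instructions : ∀ {s k g} → Enum (Instruction s k g)
queryInstructions =
  choose (allFin _) >>= λ y → choose (allFin _) >>= λ n → return (query y n)
computeInstructions = readingFunctions _ actions >>= return ∘ compute
instructions =
  choose (return accept ∷ return reject ∷ queryInstructions ∷ computeInstructions ∷ []) >>= id

hits-instructions : ∀ {s k g} (i : Instruction s k g) → Hits instructions (i ≈ᴵ_)
hits-instructions accept =
  hits->>= (hits-∈ (here refl)) λ { _ refl → hits-return accept }
hits-instructions reject =
  hits->>= (hits-∈ (there (here refl))) λ { _ refl → hits-return reject }
hits-instructions (query y n) =
  hits->>= (hits-∈ (there (there (here refl)))) λ { _ refl →
  hits->>= (hits-∈ (∈-allFin y)) λ { _ refl →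
  hits->>= (hits-∈ (∈-allFin n)) λ { _ refl → hits-return query }}}
hits-instructions (compute δ) =
  hits->>= (hits-∈ (there (there (there (here refl))))) λ { _ refl →
  hits->>= (hits-readingFunctions _ (hits-actions ∘ δ)) λ _ eq →
  hits-return (compute eq) }

-- Sizes and start state are shared, so configurations of the two machines have components of the
-- same types; only transition functions may differ, and these agree pointwise.
data _≈ᴹ_ : OracleTM → OracleTM → Set where
  similar : ∀ {s k g} {q : Fin s} {π ρ : Fin s → Instruction s (suc k) g} →
            (∀ i → π i ≈ᴵ ρ i) →
            record { states = s ; extraTapes = k ; auxSymbols = g ; start = q ; program = π } ≈ᴹ
            record { states = s ; extraTapes = k ; auxSymbols = g ; start = q ; program = ρ }

machines : Enum OracleTM
machines =
  naturals >>= λ s → naturals >>= λ k → naturals >>= λ g → choose (allFin s) >>= λ q →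
  functions instructions >>= λ π →
  return record { states = s ; extraTapes = k ; auxSymbols = g ; start = q ; program = π }

hits-machines : ∀ M → Hits machines (M ≈ᴹ_)
hits-machines M =
  hits->>= (hits-naturals states) λ { _ refl →
  hits->>= (hits-naturals extraTapes) λ { _ refl →
  hits->>= (hits-naturals auxSymbols) λ { _ refl →
  hits->>= (hits-∈ (∈-allFin start)) λ { _ refl →
  hits->>= (hits-functions (hits-instructions ∘ program)) λ _ eqs →
  hits-return (similar eqs) }}}}
  where open OracleTM M

-- How a computation depends on the machine and on the oracle.

accepts : OracleTM → Polynomial → Language → Language
accepts M p X x = accepting M (run M X (eval p (length x)) (initial M x))

asked : OracleTM → Polynomial → Language → Word → List Word
asked M p X x = queriesWithin M X (eval p (length x)) (initial M x)

module Simulation {s k g} {q : Fin s} {π ρ : Fin s → Instruction s (suc k) g}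
                  (π≈ρ : ∀ i → π i ≈ᴵ ρ i) (X : Language) where

  M N : OracleTM
  M = record { states = s ; extraTapes = k ; auxSymbols = g ; start = q ; program = π }
  N = record { states = s ; extraTapes = k ; auxSymbols = g ; start = q ; program = ρ }

  -- `Config M` and `Config N` are distinct types, so equality of components has to be a relation.
  data _~_ : Config M → Config N → Set where
    same : ∀ {i ts o} → config i ts o ~ config i ts o

  step-~ : ∀ {c d} → c ~ d → step M X c ~ step N X d
  step-~ (same {i} {ts}) with π i | ρ i | π≈ρ i
  ... | _ | _ | accept     = same
  ... | _ | _ | reject     = same
  ... | _ | _ | query      = same
  ... | _ | _ | compute eq rewrite eq (Vec.map Tape.head ts) = same

  run-~ : ∀ t {c d} → c ~ d → run M X t c ~ run N X t d
  run-~ zero    c~d = c~d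
  run-~ (suc t) c~d = run-~ t (step-~ c~d)

  queriesAt-~ : ∀ {c d} → c ~ d → queriesAt N d ≡ queriesAt M c
  queriesAt-~ (same {i}) with π i | ρ i | π≈ρ i
  ... | _ | _ | accept    = refl
  ... | _ | _ | reject    = refl
  ... | _ | _ | query     = refl
  ... | _ | _ | compute _ = refl

  queriesWithin-~ : ∀ t {c d} → c ~ d → queriesWithin N X t d ≡ queriesWithin M X t c
  queriesWithin-~ zero    c~d = refl
  queriesWithin-~ (suc t) c~d =
    cong₂ _++_ (queriesAt-~ c~d) (queriesWithin-~ t (step-~ c~d))

  accepting-~ : ∀ {c d} → c ~ d → accepting N d ≡ accepting M c
  accepting-~ (same {i}) with π i | ρ i | π≈ρ i
  ... | _ | _ | accept    = refl
  ... | _ | _ | reject    = refl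
  ... | _ | _ | query     = refl
  ... | _ | _ | compute _ = refl

accepts-≈ : ∀ {M N} → M ≈ᴹ N → ∀ p X x → accepts N p X x ≡ accepts M p X x
accepts-≈ (similar eqs) p X x = accepting-~ (run-~ (eval p (length x)) same)
  where open Simulation eqs X

asked-≈ : ∀ {M N} → M ≈ᴹ N → ∀ p X x → asked N p X x ≡ asked M p X x
asked-≈ (similar eqs) p X x = queriesWithin-~ (eval p (length x)) same
  where open Simulation eqs X

module _ (M : OracleTM) where

  step-agree : ∀ {X Y} c → All (λ q → X q ≡ Y q) (queriesAt M c) → step M X c ≡ step M Y c
  step-agree c eqs with OracleTM.program M (Config.state c) | eqs
  ... | accept    | _      = refl
  ... | reject    | _      = refl
  ... | query _ _ | eq ∷ _ rewrite eq = refl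
  ... | compute _ | _      = refl

  -- The oracle enters a run only through answers. As long as these agree the two runs pass through
  -- the same configurations, so the queries under `X` are also those under `Y`.
  run-agree : ∀ {X Y} t c → (∀ {q} → q ∈ queriesWithin M X t c → X q ≡ Y q) →
              run M X t c ≡ run M Y t c × queriesWithin M X t c ≡ queriesWithin M Y t c
  run-agree zero c eqs = refl , refl
  run-agree {X} {Y} (suc t) c eqs
    with step M Y c | step-agree {X} {Y} c (All.tabulate (eqs ∘ ∈-++⁺ˡ))
  ... | _ | refl =
    let r , q = run-agree t (step M X c) (eqs ∘ ∈-++⁺ʳ (queriesAt M c))
    in r , cong (queriesAt M c ++_) q

  queriesAt-oracleTape : ∀ {q} c → q ∈ queriesAt M c → q ≡ Config.oracleTape c
  queriesAt-oracleTape c q∈ with OracleTM.program M (Config.state c) | q∈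
  ... | query _ _ | here eq = eq

  length-append : ∀ e w → length (append e w) ≤ suc (length w)
  length-append nothing  w = n≤1+n _
  length-append (just b) w = ≤-reflexive (trans (length-++ w) (+-comm (length w) 1))

  step-oracleTape : ∀ X c →
    length (Config.oracleTape (step M X c)) ≤ suc (length (Config.oracleTape c))
  step-oracleTape X c with OracleTM.program M (Config.state c)
  ... | accept    = n≤1+n _
  ... | reject    = n≤1+n _
  ... | query _ _ = z≤n
  ... | compute δ = length-append (Action.emit (δ (Vec.map Tape.head (Config.workTapes c)))) _

  -- The oracle tape grows by at most one bit per step.
  length-query : ∀ {X q} t c → q ∈ queriesWithin M X t c →
                 length q ≤ length (Config.oracleTape c) + t
  length-query {X} (suc t) c q∈ with ∈-++⁻ (queriesAt M c) q∈
  ... | inj₁ q∈ˡ rewrite queriesAt-oracleTape c q∈ˡ = m≤m+n _ _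
  ... | inj₂ q∈ʳ = ≤-trans (length-query t (step M X c) q∈ʳ)
    (≤-trans (+-monoˡ-≤ t (step-oracleTape X c)) (≤-reflexive (sym (+-suc _ t))))

-- Target words and the tasks to be diagonalised against.

data Requirement : Set where
  longer twins : Requirement

targets : Requirement → ℕ → List Word
targets longer n = replicate (suc n) false ∷ []
targets twins  n = replicate n false ∷ replicate n true ∷ []

-- The lower bound protects the shorter words settled before a stage; the upper bound puts the
-- targets below the size of the following stage.
length-target : ∀ r n {w} → w ∈ targets r n → n ≤ length w × length w ≤ suc n
length-target longer n (here refl) rewrite length-replicate n {false} = n≤1+n _ , ≤-refl
length-target twins  n (here refl) rewrite length-replicate n {false} = ≤-refl , n≤1+n _
length-target twins  n (there (here refl)) rewrite length-replicate n {true} = ≤-refl , n≤1+n _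

anyTarget : Requirement → Language → Language
anyTarget r A x = any A (targets r (length x))

any-true : ∀ {X : Language} ws → any X ws ≡ true → ∃[ w ] w ∈ ws × X w ≡ true
any-true {X} (w ∷ ws) eq with X w in Xw
... | true  = w , here refl , Xw
... | false = let v , v∈ , Xv = any-true ws eq in v , there v∈ , Xv

any-false : ∀ {X : Language} ws → any X ws ≡ false → ∀ {w} → w ∈ ws → X w ≡ false
any-false {X} (w ∷ ws) eq w∈ with X w in Xw
any-false (w ∷ ws) eq (here refl) | false = Xw
any-false (w ∷ ws) eq (there w∈)  | false = any-false ws eq w∈

-- The polynomial is a clock that cuts runs off: every polynomial is paired with every machine,
-- without a test that it bounds the running time.
Task : Set
Task = Requirement × Polynomial × OracleTM

tasks : Enum Task
tasks =
  choose (longer ∷ twins ∷ []) >>= λ r → polynomials >>= λ p → machines >>= λ M →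
  return (r , p , M)

hits-tasks : ∀ r p M → Hits tasks (λ (r′ , p′ , N) → r ≡ r′ × p ≡ p′ × M ≈ᴹ N)
hits-tasks r p M =
  hits->>= (hits-∈ (∈-requirements r)) λ { _ refl →
  hits->>= (hits-polynomials p) λ { _ refl →
  hits->>= (hits-machines M) λ _ M≈ → hits-return (refl , refl , M≈) }}
  where
  ∈-requirements : ∀ r → r ∈ longer ∷ twins ∷ []
  ∈-requirements longer = here refl
  ∈-requirements twins  = there (here refl)

-- Construction of the oracle in stages.

module Extension (r : Requirement) (p : Polynomial) (M : OracleTM) (n : ℕ) (X : Language) where

  input : Word
  input = replicate n false

  -- After acceptance nothing is added, because the absence of all targets already refutes the
  -- verdict.
  Added : Word → Set
  Added w = accepts M p X input ≡ false × w ∈ targets r n × w ∉ asked M p X input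

  added? : Decidable Added
  added? w =
    (accepts M p X input Bool.≟ false) ×-dec (w ∈? targets r n) ×-dec ¬? (w ∈? asked M p X input)

  extend : Language
  extend w = X w ∨ does (added? w)

  extend-old : ∀ {w} → ¬ Added w → extend w ≡ X w
  extend-old {w} ¬a rewrite dec-false (added? w) ¬a = Bool.∨-identityʳ (X w)

  extend-added : ∀ {w} → Added w → extend w ≡ true
  extend-added {w} a rewrite dec-true (added? w) a = Bool.∨-zeroʳ (X w)

-- The number is the first length still open: shorter words are settled, and no word of this length
-- or more is in the language so far. It is also the length of the next input.
Stage : Set
Stage = ℕ × Language

advance : Maybe Task → Stage → Stage
-- Growth even at an index without a task keeps the size above the stage number.
advance nothing            (n , X) = suc n , X
-- This exceeds the lengths of the targets, at most n + 1, and of the queries, at most `eval p n`.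
advance (just (r , p , M)) (n , X) = 2 + n + eval p n , Extension.extend r p M n X

advance-> : ∀ m n X → n < proj₁ (advance m (n , X))
advance-> nothing            n X = ≤-refl
advance-> (just (r , p , M)) n X = s≤s (≤-trans (m≤m+n n _) (n≤1+n _))

advance-below : ∀ m n X {w} → length w < n → proj₂ (advance m (n , X)) w ≡ X w
advance-below nothing            n X w<n = refl
advance-below (just (r , p , M)) n X w<n =
  extend-old λ (_ , w∈ , _) → <⇒≱ w<n (proj₁ (length-target r n w∈))
  where open Extension r p M n X

EmptyAbove : Stage → Set
EmptyAbove (n , X) = ∀ {w} → n ≤ length w → X w ≡ false

advance-emptyAbove : ∀ m {S} → EmptyAbove S → EmptyAbove (advance m S)
advance-emptyAbove nothing            empty n<w = empty (<⇒≤ n<w)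
advance-emptyAbove (just (r , p , M)) {n , X} empty n′≤w =
  trans (extend-old λ (_ , w∈ , _) →
          <⇒≱ (≤-trans (s≤s (s≤s (m≤m+n n _))) n′≤w) (proj₂ (length-target r n w∈)))
        (empty (≤-trans (<⇒≤ (advance-> (just (r , p , M)) n X)) n′≤w))
  where open Extension r p M n X

stage : ℕ → Stage
-- Starting at 1 makes every input nonempty, so that 0ⁿ and 1ⁿ are distinct, and gives `size->` its
-- base case.
stage zero    = 1 , const false
stage (suc e) = advance (tasks .at e) (stage e)

size : ℕ → ℕ
size = proj₁ ∘ stage

approx : ℕ → Language
approx = proj₂ ∘ stage

size-> : ∀ e → e < size e
size-> zero    = ≤-refl
size-> (suc e) = ≤-<-trans (size-> e) (advance-> (tasks .at e) _ _)

size-mono : ∀ e d → size e ≤ size (d + e)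
size-mono e zero    = ≤-refl
size-mono e (suc d) = ≤-trans (size-mono e d) (<⇒≤ (advance-> (tasks .at (d + e)) _ _))

approx-emptyAbove : ∀ e → EmptyAbove (stage e)
approx-emptyAbove zero    _ = refl
approx-emptyAbove (suc e)   = advance-emptyAbove (tasks .at e) (approx-emptyAbove e)

approx-stable : ∀ e d {w} → length w < size e → approx (d + e) w ≡ approx e w
approx-stable e zero    w< = refl
approx-stable e (suc d) w< =
  trans (advance-below (tasks .at (d + e)) _ _ (<-≤-trans w< (size-mono e d))) (approx-stable e d w<)

approx-agree : ∀ {d e w} → d ≤ e → length w < size d → approx e w ≡ approx d w
approx-agree {d} {e} {w} d≤e w< =
  subst (λ k → approx k w ≡ approx d w) (m∸n+n≡m d≤e) (approx-stable d (e ∸ d) {w} w<)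

-- The limit of the stages, read off at a stage that has already settled `w`: by `size->` stage
-- `length w` has size above `length w`.
oracle : Language
oracle w = approx (length w) w

oracle-approx : ∀ e {w} → length w < size e → oracle w ≡ approx e w
oracle-approx e {w} w< with ≤-total (length w) e
... | inj₁ w≤e = sym (approx-agree {w = w} w≤e (size-> (length w)))
... | inj₂ e≤w = approx-agree {w = w} e≤w w<

-- A machine deciding one of the two sets queries all targets of some input.

module _ (r : Requirement) (p : Polynomial) (M : OracleTM)
         (M-decides : ∀ x → accepts M p oracle x ≡ anyTarget r oracle x) where

  private
    module Stage-met (e : ℕ) (N : OracleTM) (taskₑ : tasks .at e ≡ just (r , p , N)) (M≈N : M ≈ᴹ N) where

      n : ℕ
      n = size e

      X : Language
      X = approx e

      open Extension r p N n X

      length-input : length input ≡ n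
      length-input = length-replicate n

      oracle-extend : ∀ {w} → length w < 2 + n + eval p n → oracle w ≡ extend w
      oracle-extend {w} w< =
        trans (oracle-approx (suc e)
                (subst (λ m → length w < proj₁ (advance m (stage e))) (sym taskₑ) w<))
              (cong (λ m → proj₂ (advance m (stage e)) w) taskₑ)

      oracle-target : ∀ {w} → w ∈ targets r n → oracle w ≡ extend w
      oracle-target w∈ =
        oracle-extend (≤-trans (s≤s (proj₂ (length-target r n w∈))) (m≤m+n (2 + n) _))

      -- Queries lie below the size of the next stage, so this stage settles them, and it adds no
      -- queried word.
      oracle-asked : ∀ {q} → q ∈ asked N p X input → X q ≡ oracle q
      oracle-asked {q} q∈ = sym (trans (oracle-extend short) (extend-old λ (_ , _ , q∉) → q∉ q∈))
        where
        short : length q < 2 + n + eval p n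
        short = s≤s (≤-trans (length-query N (eval p (length input)) (initial N input) q∈)
          (≤-trans (≤-reflexive (cong (eval p) length-input)) (m≤n+m _ (suc n))))

      agree : run N X (eval p (length input)) (initial N input)
                ≡ run N oracle (eval p (length input)) (initial N input)
            × asked N p X input ≡ asked N p oracle input
      agree = run-agree N (eval p (length input)) (initial N input) oracle-asked

      verdict : accepts N p X input ≡ any oracle (targets r n)
      verdict = begin
        accepts N p X input                    ≡⟨ cong (accepting N) (proj₁ agree) ⟩
        accepts N p oracle input               ≡⟨ accepts-≈ M≈N p oracle input ⟩
        accepts M p oracle input               ≡⟨ M-decides input ⟩
        any oracle (targets r (length input))  ≡⟨ cong (any oracle ∘ targets r) length-input ⟩
        any oracle (targets r n)               ∎
        where open ≡-Reasoning

      -- Acceptance would need a target in the oracle, but then none was added and `X` has no words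
      -- this long. After rejection an unqueried target would have been added, although rejection
      -- says that the oracle contains none.
      asked-all : ∀ {w} → w ∈ targets r n → w ∈ asked N p X input
      asked-all {w} w∈ with accepts N p X input in verdictₑ
      ... | true =
        let v , v∈ , v-in = any-true (targets r n) (trans (sym verdict) verdictₑ)
            v-out = begin
              oracle v  ≡⟨ oracle-target v∈ ⟩
              extend v  ≡⟨ extend-old (λ (rejects , _) →
                             contradiction (trans (sym verdictₑ) rejects) λ ()) ⟩
              X v       ≡⟨ approx-emptyAbove e (proj₁ (length-target r n v∈)) ⟩
              false     ∎
        in contradiction (trans (sym v-in) v-out) λ ()
        where open ≡-Reasoning
      ... | false = decidable-stable (w ∈? asked N p X input) λ w∉ →
        contradiction (begin
          true      ≡⟨ extend-added (verdictₑ , w∈ , w∉) ⟨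
          extend w  ≡⟨ oracle-target w∈ ⟨
          oracle w  ≡⟨ any-false (targets r n) (trans (sym verdict) verdictₑ) w∈ ⟩
          false     ∎) λ ()
        where open ≡-Reasoning

  -- The task met at stage `e` carries a machine `N` that agrees with `M` pointwise and hence asks
  -- `oracle` the same queries. Positivity of n separates the twins.
  targets-asked : ∃[ n ] 0 < n ×
                  (∀ {w} → w ∈ targets r n → w ∈ asked M p oracle (replicate n false))
  targets-asked with hits-tasks r p M
  ... | hit {e} {_ , _ , N} taskₑ (refl , refl , M≈N) =
    size e , ≤-trans (s≤s z≤n) (size-> e) ,
    λ w∈ → subst (_ ∈_) (trans (proj₂ agree) (asked-≈ M≈N p oracle input)) (asked-all w∈)
    where
    open Stage-met e N taskₑ M≈N
    open Extension r p N (size e) (approx e) using (input)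

-- The two failures of reducibility.

longer-hard : ¬ (anyTarget longer oracle ≤s-lni-T oracle)
longer-hard (M , decides , shape)
  with n , _ , covered ← targets-asked longer (DPTM.bound M) (DPTM.machine M) decides
  with covered (here refl) | shape (replicate n false)
... | w∈ | inj₁ none with () ← subst (_ ∈_) none w∈
-- The chain begins with the input length, so by transitivity n bounds every query, including the
-- target of length n + 1.
... | w∈ | inj₂ lni with bounded ∷ _ ← Linked.Linked⇒AllPairs (λ i≥j j≥k → ≤-trans j≥k i≥j) lni =
  1+n≰n {n} (begin
    suc n                               ≡⟨ length-replicate (suc n) ⟨
    length (replicate (suc n) false)    ≤⟨ All.lookup bounded (∈-map⁺ length w∈) ⟩
    length (replicate n false)          ≡⟨ length-replicate n ⟩
    n                                   ∎)
  where open ≤-Reasoning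

allPairs-∈ : {R : A → A → Set} {xs : List A} → AllPairs R xs → ∀ {u v} → u ∈ xs → v ∈ xs →
             u ≡ v ⊎ R u v ⊎ R v u
allPairs-∈ (_ ∷ _)   (here refl) (here refl) = inj₁ refl
allPairs-∈ (rs ∷ _)  (here refl) (there v∈)  = inj₂ (inj₁ (All.lookup rs v∈))
allPairs-∈ (rs ∷ _)  (there u∈)  (here refl) = inj₂ (inj₂ (All.lookup rs u∈))
allPairs-∈ (_ ∷ rss) (there u∈)  (there v∈)  = allPairs-∈ rss u∈ v∈

twins-hard : ¬ (anyTarget twins oracle ≤ld-T oracle)
twins-hard (M , decides , shape)
  -- With positive length the targets differ in their first letter, so the case of equal queries
  -- below is absurd.
  with suc n , _ , covered ← targets-asked twins (DPTM.bound M) (DPTM.machine M) decides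
  with covered (here refl) | covered (there (here refl)) | shape (replicate (suc n) false)
... | u∈ | _  | inj₁ none with () ← subst (_ ∈_) none u∈
... | u∈ | v∈ | inj₂ ld
  with allPairs-∈ (Linked.Linked⇒AllPairs (λ i>j j>k → <-trans j>k i>j) (Linked.map⁻ ld)) u∈ v∈
... | inj₂ (inj₁ u>v) = <-irrefl (trans (length-replicate n) (sym (length-replicate n))) (s≤s⁻¹ u>v)
... | inj₂ (inj₂ v>u) = <-irrefl (trans (length-replicate n) (sym (length-replicate n))) (s≤s⁻¹ v>u)

-- Scanning machines and the two reductions.

replicate-∷ʳ : ∀ m (a : A) → replicate m a ∷ʳ a ≡ replicate (suc m) a
replicate-∷ʳ zero    a = refl
replicate-∷ʳ (suc m) a = cong (a ∷_) (replicate-∷ʳ m a)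

-- This is 2n + 4: n steps right, a turn, a query, n steps back, a step leaving the loop, and a
-- second query.
bound : Polynomial
bound = 4 ∷ 2 ∷ []

eval-bound : ∀ n → eval bound n ≡ n + (2 + (n + 2))
eval-bound n = identity n
  where
  identity : ∀ n → 4 + n * (2 + n * 0) ≡ n + (2 + (n + 2))
  identity = solve-∀

-- Walking right over the input the scanner emits a 0 for every cell; at the end
-- of the input it emits e and queries.  If the answer is negative it goes on in
-- state n, where state 2 walks back over the input with a 1 for every cell.
module Scanner (e : Maybe Bool) (n : Fin 6) where

  program : Fin 6 → Instruction 6 1 0
  program 0F = compute λ
    -- Overwriting with a fixed bit leaves a tape that depends only on the input length.
    { (bit _ ∷ []) → action 0F ((bit true , right) ∷ []) (just false)
    ; (_     ∷ []) → action 1F ((blank , left) ∷ []) e }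
  program 1F = query 4F n
  program 2F = compute λ
    { (bit _ ∷ []) → action 2F ((blank , left) ∷ []) (just true)
    ; (_     ∷ []) → action 3F ((blank , stay) ∷ []) nothing }
  program 3F = query 4F 5F
  program 4F = accept
  program 5F = reject

  machine : OracleTM
  machine = record { states = 6 ; extraTapes = 0 ; auxSymbols = 0 ; start = 0F ; program = program }

  -- Verdict, halting and query list are bundled because one induction carries all three back from
  -- the end of a run to its start.
  Yields : Language → ℕ → Config machine → Bool → List Word → Set
  Yields X t c b qs =
    accepting machine (run machine X t c) ≡ b ×
    Halted machine (run machine X t c) ×
    queriesWithin machine X t c ≡ qs

  rightTape : ℕ → Word → Tape 0
  rightTape m []      = tape (replicate m (bit true)) blank []
  rightTape m (b ∷ w) = tape (replicate m (bit true)) (bit b) (map bit w)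

  -- The number counts the cells still to be erased, the scanned one included; the list holds what
  -- lies to the right.
  leftTape : ℕ → List (Symbol 0) → Tape 0
  leftTape zero    as = tape [] blank as
  leftTape (suc m) as = tape (replicate m (bit true)) (bit true) as

  inputTape-right : ∀ x → inputTape x ≡ rightTape 0 x
  inputTape-right []      = refl
  inputTape-right (_ ∷ _) = refl

  move-right : ∀ m w →
    move right (tape (replicate m (bit true)) (bit true) (map bit w)) ≡ rightTape (suc m) w
  move-right m []      = refl
  move-right m (_ ∷ _) = refl

  move-left : ∀ m a as → move left (tape (replicate m (bit true)) a as) ≡ leftTape m (a ∷ as)
  move-left zero    a as = refl
  move-left (suc m) a as = refl

  module _ {X : Language} where

    yields-accept : ∀ t {ts o} → Yields X t (config 4F ts o) true []
    yields-accept zero    = refl , tt , refl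
    yields-accept (suc t) = yields-accept t

    yields-reject : ∀ t {ts o} → Yields X t (config 5F ts o) false []
    yields-reject zero    = refl , tt , refl
    yields-reject (suc t) = yields-reject t

    yields-right : ∀ w m {t b qs} →
      Yields X t (config 0F (rightTape (length w + m) [] ∷ []) (replicate (length w + m) false)) b qs →
      Yields X (length w + t) (config 0F (rightTape m w ∷ []) (replicate m false)) b qs
    yields-right []      m y = y
    yields-right (_ ∷ w) m {t} {b} {qs} y
      rewrite move-right m w | replicate-∷ʳ m false =
      yields-right w (suc m) {t}
        (subst (λ k → Yields X t (config 0F (rightTape k [] ∷ []) (replicate k false)) b qs)
               (sym (+-suc (length w) m)) y)

    -- Invariant of the walk back: m ones are emitted and k cells remain, so their sum is the length
    -- of the coming query.
    yields-left : ∀ k m as →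
      Yields X (k + 2) (config 2F (leftTape k as ∷ []) (replicate m true))
             (X (replicate (k + m) true)) (replicate (k + m) true ∷ [])
    yields-left zero    m as with X (replicate m true)
    ... | true  = refl , tt , refl
    ... | false = refl , tt , refl
    yields-left (suc k) m as
      rewrite move-left k blank as | replicate-∷ʳ m true =
      subst (λ j → Yields X (k + 2) (config 2F (leftTape k (blank ∷ as) ∷ []) (replicate (suc m) true))
                     (X (replicate j true)) (replicate j true ∷ []))
            (+-suc k m) (yields-left k (suc m) (blank ∷ as))

    -- The phase common to both machines: it ends just before the first query, with the head already
    -- in place for a walk back.
    yields-initial : ∀ x {b qs} →
      Yields X (suc (length x + 2))
        (config 1F (leftTape (length x) (blank ∷ []) ∷ []) (append e (replicate (length x) false))) b qs →
      Yields X (eval bound (length x)) (initial machine x) b qs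
    yields-initial x {b} {qs} y =
      subst₂ (λ t T → Yields X t (config 0F (T ∷ []) []) b qs)
             (sym (eval-bound (length x))) (sym (inputTape-right x))
             (yields-right x 0 {suc (suc (length x + 2))} turn)
      where
      turn : Yields X (suc (suc (length x + 2)))
               (config 0F (rightTape (length x + 0) [] ∷ []) (replicate (length x + 0) false)) b qs
      turn rewrite +-identityʳ (length x) | move-left (length x) blank [] = y

longer-easy : ∀ A → anyTarget longer A ≤ld-T A
longer-easy A =
  record { machine = machine ; bound = bound ; halts = λ X x → proj₁ (proj₂ (yields X x)) } ,
  (λ x → proj₁ (yields A x)) ,
  λ x → inj₂ (subst (Linked _>_ ∘ map length) (sym (proj₂ (proj₂ (yields A x)))) [-])
  where
  -- The extra 0 at the turn makes the only query 0ⁿ⁺¹; a negative answer rejects at once.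
  open Scanner (just false) 5F
  yields : ∀ X x → Yields X (eval bound (length x)) (initial machine x)
                     (anyTarget longer X x) (replicate (suc (length x)) false ∷ [])
  yields X x = yields-initial x answer
    where
    answer : Yields X (suc (length x + 2))
      (config 1F (leftTape (length x) (blank ∷ []) ∷ []) (replicate (length x) false ∷ʳ false))
      (anyTarget longer X x) (replicate (suc (length x)) false ∷ [])
    answer rewrite replicate-∷ʳ (length x) false with X (replicate (suc (length x)) false)
    ... | true  = let b , h , q = yields-accept (length x + 2) in b , h , cong (_ ∷_) q
    ... | false = let b , h , q = yields-reject (length x + 2) in b , h , cong (_ ∷_) q

twins-easy : ∀ A → anyTarget twins A ≤s-lni-T A
twins-easy A =
  record { machine = machine ; bound = bound ; halts = λ X x → proj₁ (proj₂ (yields X x)) } ,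
  (λ x → proj₁ (yields A x)) ,
  λ x → inj₂ (subst (λ qs → Linked _≥_ (length x ∷ map length qs))
                    (sym (proj₂ (proj₂ (yields A x)))) (monotone (A (zeros x)) x))
  where
  -- With nothing emitted at the turn the first query is 0ⁿ; only a negative answer starts the walk
  -- back that produces 1ⁿ.
  open Scanner nothing 2F

  zeros ones : Word → Word
  zeros x = replicate (length x) false
  ones  x = replicate (length x) true

  twinQueries : Bool → Word → List Word
  twinQueries b x = zeros x ∷ (if b then [] else ones x ∷ [])

  yields : ∀ X x → Yields X (eval bound (length x)) (initial machine x)
                     (anyTarget twins X x) (twinQueries (X (zeros x)) x)
  yields X x = yields-initial x answer
    where
    answer : Yields X (suc (length x + 2))
      (config 1F (leftTape (length x) (blank ∷ []) ∷ []) (zeros x))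
      (anyTarget twins X x) (twinQueries (X (zeros x)) x)
    answer with X (zeros x)
    ... | true  = let b , h , q = yields-accept (length x + 2) in b , h , cong (_ ∷_) q
    ... | false =
      let b , h , q = subst (λ k → Yields X (length x + 2)
                              (config 2F (leftTape (length x) (blank ∷ []) ∷ []) [])
                              (X (replicate k true)) (replicate k true ∷ []))
                            (+-identityʳ (length x)) (yields-left (length x) 0 (blank ∷ []))
      in trans b (sym (Bool.∨-identityʳ _)) , h , cong (_ ∷_) q

  monotone : ∀ b x → Linked _≥_ (length x ∷ map length (twinQueries b x))
  monotone true  x = ≤-reflexive (length-replicate (length x)) ∷ [-]
  monotone false x =
    ≤-reflexive (length-replicate (length x)) ∷
    ≤-reflexive (trans (length-replicate (length x)) (sym (length-replicate (length x)))) ∷ [-]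

theorem4p13 : ∃[ A ] ∃[ B ] ∃[ C ]
    ((B ≤ld-T A) × (¬ (B ≤s-lni-T A)) × (C ≤s-lni-T A) × (¬ (C ≤ld-T A)))
theorem4p13 = oracle , anyTarget longer oracle , anyTarget twins oracle ,
  longer-easy oracle , longer-hard , twins-easy oracle , twins-hard
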